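{- Let $S$ be an infinite set and $\mathcal{F}\subseteq 2^S$ countable, nontrivial, and closed under finite unions and finite intersections. Let $\mathbf{A}=(A_1,\dots,A_k)$ be a classification problem with $k\ge 2$, and let $C\subseteq S\setminus(A_1\cup\dots\cup A_k)$ be $\mathcal{F}$-cohesive with $(C,A_i)\notin\mathit{class}_2(\mathcal{F})$ for $1\le i\le k$. Then there exists $\mathbf{B}\le\mathbf{A}$ with $|\mathbf{B}|=k$ and $\mathbf{B}\in\mathit{core}_k(\mathcal{F})$.
   Context: $\mathcal{F}$ is nontrivial if $\emptyset,S\in\mathcal{F}$ and for all $Q\in\mathcal{F}$ and finite $E\subseteq S$ both $Q\cup E\in\mathcal{F}$ and $Q\setminus E\in\mathcal{F}$. A classification problem is a vector $(A_1,\dots,A_k)$, $k\ge1$, of pairwise disjoint infinite subsets of $S$, of length $k$. For vectors $\mathbf{B}=(B_1,\dots,B_m)$, $\mathbf{Q}=(Q_1,\dots,Q_k)$, $\mathbf{B}\le\mathbf{Q}$ means $1\le m\le k$ and there is an injective $\sigma:\{1,\dots,m\}\to\{1,\dots,k\}$ with $B_i\subseteq Q_{\sigma(i)}$. An $\mathcal{F}$-partition is a vector of pairwise disjoint members of $\mathcal{F}$ whose union is $S$. $\mathit{class}_k(\mathcal{F})$: classification problems of length $k$ with $\mathbf{A}\le\mathbf{Q}$ for some $\mathcal{F}$-partition $\mathbf{Q}$ of length $k$ (for $k=2$, $(C,A_i)\in\mathit{class}_2(\mathcal{F})$ requires in particular $C$ infinite). For $k>1$, $\mathit{core}_k(\mathcal{F})$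 is the set of classification problems $\mathbf{A}$ of length $k$ (in particular with infinite, pairwise disjoint components) such that every classification problem $\mathbf{A}'\le\mathbf{A}$ with $|\mathbf{A}'|>1$ satisfies $\mathbf{A}'\notin\mathit{class}_{|\mathbf{A}'|}(\mathcal{F})$. A set $A\subseteq S$ is $\mathcal{F}$-cohesive if $A$ is infinite and for every $Q$ with $Q\in\mathcal{F}$ and $S\setminus Q\in\mathcal{F}$, either $A\cap Q$ or $A\setminus Q$ is finite. -}

module Defs where

open import Data.Fin.Base using (Fin)
open import Data.List.Membership.Propositional using () renaming (_∈_ to _∈ₗ_)
open import Data.Nat.Base using (ℕ; _≤_; _<_)
open import Data.Product.Base using (Σ; ∃-syntax; _×_; proj₁)
open import Data.Sum.Base using (_⊎_)
open import Data.Vec.Functional using (Vector)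
open import Function.Bundles using (Injection)
open import Function.Definitions using (Injective)
open import Level using (Level; suc; _⊔_)
open import Relation.Binary.Bundles using (Setoid)
import Relation.Binary.Construct.On as On
open import Relation.Binary.PropositionalEquality using (_≡_; _≢_; setoid)
open import Relation.Nullary using (¬_)
open import Relation.Unary using (Pred; _∈_; _∉_; _⊆_; _≐_; _⊥_; ∁; _∪_; _∩_; _∖_; ⋃; ⋂)
open import Relation.Unary.Polymorphic using (∅; U)
open import Relation.Unary.Relation.Binary.Equality using (≐-setoid)

private
  variable
    a b : Level
    k m : ℕ

Subset : Set a → Set (suc a)
Subset {a} S = Pred S a

-- Families are predicates on Subset S; as subsets are only compared up to _≐_,
-- a genuine family F ⊆ 2^S is one that moreover satisfies F Respects _≐_.
Family : Set a → (b : Level) → Set (suc a ⊔ suc b)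
Family S b = Pred (Subset S) b

Finite : {S : Set a} → Subset S → Set a
Finite {S = S} A = ∃[ xs ] A ≐ (λ (x : S) → x ∈ₗ xs)

Infinite : {S : Set a} → Subset S → Set a
Infinite A = ¬ Finite A

-- The members of F, identified when they have the same elements.
members : {S : Set a} → Family S b → Setoid (suc a ⊔ b) a
members {a = a} {S = S} F = On.setoid (≐-setoid S a) (proj₁ {B = λ Q → Q ∈ F})

Countable : {S : Set a} → Family S b → Set (suc a ⊔ b)
Countable F = Injection (members F) (setoid ℕ)

Nontrivial : {S : Set a} → Family S b → Set (suc a ⊔ b)
Nontrivial {S = S} F =
  ∅ ∈ F × U ∈ F ×
  (∀ (Q E : Subset S) → Q ∈ F → Finite E → (Q ∪ E) ∈ F × (Q ∖ E) ∈ F)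

-- The empty union and intersection are ∅ and S, which lie in every nontrivial F.
ClosedUnderFiniteUnions : {S : Set a} → Family S b → Set (suc a ⊔ b)
ClosedUnderFiniteUnions {S = S} F =
  ∀ (n : ℕ) (Q : Vector (Subset S) n) → (∀ i → Q i ∈ F) → ⋃ (Fin n) Q ∈ F

ClosedUnderFiniteIntersections : {S : Set a} → Family S b → Set (suc a ⊔ b)
ClosedUnderFiniteIntersections {S = S} F =
  ∀ (n : ℕ) (Q : Vector (Subset S) n) → (∀ i → Q i ∈ F) → ⋂ (Fin n) Q ∈ F

PairwiseDisjoint : {S : Set a} → Vector (Subset S) k → Set a
PairwiseDisjoint A = ∀ i j → i ≢ j → A i ⊥ A j

IsClassificationProblem : {S : Set a} → Vector (Subset S) k → Set a
IsClassificationProblem {k = k} A =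
  1 ≤ k × (∀ i → Infinite (A i)) × PairwiseDisjoint A

infix 4 _≼_

_≼_ : {S : Set a} → Vector (Subset S) m → Vector (Subset S) k → Set a
_≼_ {m = m} {k = k} B Q =
  1 ≤ m × m ≤ k ×
  Σ (Fin m → Fin k) λ σ → Injective _≡_ _≡_ σ × (∀ i → B i ⊆ Q (σ i))

IsPartition : {S : Set a} → Family S b → Vector (Subset S) k → Set (a ⊔ b)
IsPartition {a = a} {k = k} F Q =
  (∀ i → Q i ∈ F) × PairwiseDisjoint Q × ⋃ (Fin k) Q ≐ U {ℓ = a}

class : {S : Set a} (k : ℕ) → Family S b → Pred (Vector (Subset S) k) (suc a ⊔ b)
class {S = S} k F A =
  IsClassificationProblem A ×
  Σ (Vector (Subset S) k) λ Q → IsPartition F Q × A ≼ Q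

core : {S : Set a} (k : ℕ) → Family S b → Pred (Vector (Subset S) k) (suc a ⊔ b)
core {S = S} k F A =
  1 < k × IsClassificationProblem A ×
  (∀ (m : ℕ) (A′ : Vector (Subset S) m) →
     IsClassificationProblem A′ → A′ ≼ A → 1 < m → A′ ∉ class m F)

Cohesive : {S : Set a} → Family S b → Subset S → Set (suc a ⊔ b)
Cohesive {S = S} F A =
  Infinite A ×
  (∀ (Q : Subset S) → Q ∈ F → ∁ Q ∈ F → Finite (A ∩ Q) ⊎ Finite (A ∖ Q))

{-# OPTIONS --safe #-}
-- Let D be the Boolean algebra of those Q with both Q and S ∖ Q in F.  As C is
-- cohesive, the Q ∈ D that almost contain C form a countable ultrafilter of D,
-- and inseparability of C and A i makes A i meet every member of it in an
-- infinite set.  So each A i contains an infinite B i that is almost contained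
-- in every member of the ultrafilter: diagonalise against an enumeration of it.
-- Every part of an F-partition lies in D, so at most one of its parts can
-- contain infinitely many elements of the B i.
module Submission where

open import Defs
open import Axiom.ExcludedMiddle using (ExcludedMiddle)
open import Data.Fin.Base using (Fin; zero; suc; toℕ; punchIn; punchOut)
open import Data.Fin.Properties using (_≟_; pigeonhole; punchInᵢ≢i; punchIn-punchOut)
open import Data.List.Base as List using (List; _++_; filter; length; lookup)
open import Data.List.Membership.Propositional using () renaming (_∈_ to _∈ₗ_)
open import Data.List.Membership.Propositional.Properties using (∈-filter⁺; ∈-filter⁻; ∈-++⁺ˡ; ∈-++⁺ʳ)
open import Data.List.Relation.Unary.Any using (here; there; index)
open import Data.List.Relation.Unary.Any.Properties using (lookup-index)
open import Data.Nat.Base using (ℕ; zero; suc; _≤_; _<_; _≤′_; ≤′-refl; ≤′-step; z≤n; s≤s)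
open import Data.Nat.Properties using (≤-refl; n<1+n; ≤⇒≤′; _<?_; ≮⇒≥)
open import Data.Product.Base using (Σ; ∃-syntax; _×_; _,_; proj₁; proj₂)
open import Data.Sum.Base using (_⊎_; inj₁; inj₂; [_,_])
open import Data.Vec.Functional using (Vector; _∷_; [])
open import Function.Base using (id; _∘_)
open import Function.Bundles using (Injection)
open import Level using (Level; _⊔_; Lift; lift; lower) renaming (suc to lsuc)
open import Relation.Binary.Definitions using (_Respects_)
open import Relation.Binary.PropositionalEquality using (_≡_; _≢_; refl; sym; trans; cong; subst)
open import Relation.Nullary using (¬_; Dec; yes; no; contradiction)
open import Relation.Nullary.Decidable using (map′; decidable-stable)
open import Relation.Unary using (Pred; _∈_; _∉_; _⊆_; _≐_; _⊥_; ∁; _∪_; _∩_; _∖_; ⋃)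
open import Relation.Unary.Polymorphic using (U)

private
  variable
    a : Level

-- Membership questions live at level `a`, whereas the search for a coded set quantifies over
-- subsets and needs the larger level; one assumption covers both.
lowerEM : ∀ b → ExcludedMiddle (lsuc a ⊔ b) → ExcludedMiddle a
lowerEM {a} b em {P} = map′ lower lift (em {Lift (lsuc a ⊔ b) P})

-- By pigeonhole: if a list held the whole range, two of the first `length xs` + 1 values would
-- share a position in it.
infinite-range : {S : Set a} (f : ℕ → S) → (∀ {m n} → m < n → f m ≢ f n) →
                 Infinite (λ x → ∃[ n ] x ≡ f n)
infinite-range f f-distinct (xs , range⊆xs , _) = f-distinct i<j fi≡fj
  where
  f∈xs : ∀ n → f n ∈ₗ xs
  f∈xs n = range⊆xs (n , refl)

  collision = pigeonhole (n<1+n (length xs)) (λ i → index (f∈xs (toℕ i)))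
  i = proj₁ collision
  j = proj₁ (proj₂ collision)
  i<j = proj₁ (proj₂ (proj₂ collision))

  fi≡fj : f (toℕ i) ≡ f (toℕ j)
  fi≡fj = trans (lookup-index (f∈xs (toℕ i)))
         (trans (cong (lookup xs) (proj₂ (proj₂ (proj₂ collision))))
                (sym (lookup-index (f∈xs (toℕ j)))))

-- Finite sets and diagonalisation.

module FiniteSets (em : ExcludedMiddle a) {S : Set a} where

  private
    variable
      X Y : Subset S

  -- `Finite` asks for a list with exactly the elements of the set, so a list that merely covers it
  -- is filtered.
  listed⇒finite : ∀ xs → (∀ {x} → X x → x ∈ₗ xs) → Finite X
  listed⇒finite {X} xs X⊆xs =
    filter X? xs , (λ x∈X → ∈-filter⁺ X? (X⊆xs x∈X) x∈X) , (λ x∈ → proj₂ (∈-filter⁻ X? {xs = xs} x∈))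
    where
    X? : ∀ x → Dec (X x)
    X? _ = em

  finite-⊆ : X ⊆ Y → Finite Y → Finite X
  finite-⊆ X⊆Y (xs , Y⊆xs , _) = listed⇒finite xs (Y⊆xs ∘ X⊆Y)

  pick : Infinite X → ∀ xs → ∃[ x ] (X x × ¬ (x ∈ₗ xs))
  pick {X} X-inf xs with em {∃[ x ] (X x × ¬ (x ∈ₗ xs))}
  ... | yes x = x
  ... | no ∄x = contradiction
    (listed⇒finite xs (λ {x} x∈X → decidable-stable em (λ x∉xs → ∄x (x , x∈X , x∉xs)))) X-inf

  -- An infinite pseudo-intersection of a decreasing sequence X.
  module Diagonal (X : ℕ → Subset S) (X-inf : ∀ n → Infinite (X n))
                  (X-dec : ∀ n → X (suc n) ⊆ X n) where

    -- Built by mutual recursion with `choice`: `chosen n` lists the points with index below `n`,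
    -- which the next point must avoid.
    chosen : ℕ → List S

    choice : ∀ n → ∃[ x ] (X n x × ¬ (x ∈ₗ chosen n))
    choice n = pick (X-inf n) (chosen n)

    chosen zero    = List.[]
    chosen (suc n) = proj₁ (choice n) List.∷ chosen n

    point : ℕ → S
    point n = proj₁ (choice n)

    range : Subset S
    range x = ∃[ n ] x ≡ point n

    point∈chosen : ∀ {m n} → suc m ≤′ n → point m ∈ₗ chosen n
    point∈chosen ≤′-refl       = here refl
    point∈chosen (≤′-step m<n) = there (point∈chosen m<n)

    range-infinite : Infinite range
    range-infinite = infinite-range point λ {m} {n} m<n pm≡pn →
      proj₂ (proj₂ (choice n)) (subst (_∈ₗ chosen n) pm≡pn (point∈chosen (≤⇒≤′ m<n)))

    X-antitone : ∀ {m n} → m ≤′ n → X n ⊆ X m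
    X-antitone ≤′-refl       = id
    X-antitone (≤′-step m≤n) = X-antitone m≤n ∘ X-dec _

    range⊆X₀ : range ⊆ X 0
    range⊆X₀ (n , refl) = X-antitone (≤⇒≤′ z≤n) (proj₁ (proj₂ (choice n)))

    -- From index `n` on, every point lies in `X n`, since the sequence decreases; only the points
    -- in `chosen n` can fall outside.
    range∖X-finite : ∀ n → Finite (range ∖ X n)
    range∖X-finite n = listed⇒finite (chosen n) listed
      where
      listed : ∀ {x} → (range ∖ X n) x → x ∈ₗ chosen n
      listed ((m , refl) , pm∉X) with m <? n
      ... | yes m<n = point∈chosen (≤⇒≤′ m<n)
      ... | no  m≮n = contradiction (X-antitone (≤⇒≤′ (≮⇒≥ m≮n)) (proj₁ (proj₂ (choice m)))) pm∉X

-- The Boolean algebra of complemented sets, and separation by its members.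

module Separation
  {a b : Level} (em : ExcludedMiddle (lsuc a ⊔ b)) {S : Set a}
  (F : Family S b) (F-resp : F Respects _≐_) (F-countable : Countable F) (F-nontrivial : Nontrivial F)
  (F-⋃ : ClosedUnderFiniteUnions F) (F-⋂ : ClosedUnderFiniteIntersections F)
  where

  private
    variable
      P Q X C : Subset S

  em₀ : ExcludedMiddle a
  em₀ = lowerEM b em

  open FiniteSets em₀ {S}

  ∪-closed : P ∈ F → Q ∈ F → (P ∪ Q) ∈ F
  ∪-closed {P} {Q} P∈F Q∈F = F-resp
    ((λ { (zero , x∈P) → inj₁ x∈P ; (suc zero , x∈Q) → inj₂ x∈Q }) ,
     (λ { (inj₁ x∈P) → zero , x∈P ; (inj₂ x∈Q) → suc zero , x∈Q }))
    (F-⋃ 2 (P ∷ Q ∷ []) λ { zero → P∈F ; (suc zero) → Q∈F })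

  ∩-closed : P ∈ F → Q ∈ F → (P ∩ Q) ∈ F
  ∩-closed {P} {Q} P∈F Q∈F = F-resp
    ((λ x∈ → x∈ zero , x∈ (suc zero)) ,
     (λ { (x∈P , x∈Q) zero → x∈P ; (x∈P , x∈Q) (suc zero) → x∈Q }))
    (F-⋂ 2 (P ∷ Q ∷ []) λ { zero → P∈F ; (suc zero) → Q∈F })

  Complemented : Pred (Subset S) b
  Complemented Q = Q ∈ F × ∁ Q ∈ F

  ∁-complemented : Complemented Q → Complemented (∁ Q)
  ∁-complemented (Q∈F , ∁Q∈F) =
    ∁Q∈F , F-resp ((λ x∈Q x∉Q → x∉Q x∈Q) , decidable-stable em₀) Q∈F

  ∩-complemented : Complemented P → Complemented Q → Complemented (P ∩ Q)
  ∩-complemented {P} {Q} (P∈F , ∁P∈F) (Q∈F , ∁Q∈F) =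
    ∩-closed P∈F Q∈F , F-resp (to , from) (∪-closed ∁P∈F ∁Q∈F)
    where
    to : (∁ P ∪ ∁ Q) ⊆ ∁ (P ∩ Q)
    to = [ (λ x∉P → x∉P ∘ proj₁) , (λ x∉Q → x∉Q ∘ proj₂) ]

    from : ∁ (P ∩ Q) ⊆ (∁ P ∪ ∁ Q)
    from {x} x∉P∩Q with em₀ {P x}
    ... | yes x∈P = inj₂ (λ x∈Q → x∉P∩Q (x∈P , x∈Q))
    ... | no  x∉P = inj₁ x∉P

  U-complemented : Complemented U
  U-complemented =
    proj₁ (proj₂ F-nontrivial) , F-resp ((λ ()) , (λ x∉U → contradiction _ x∉U)) (proj₁ F-nontrivial)

  -- The complement of one part is the union of the others, which `punchIn i` enumerates.
  part-complemented : ∀ {m} {Q : Vector (Subset S) m} → IsPartition F Q → ∀ i → Complemented (Q i)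
  part-complemented {suc m} {Q} (Q∈F , disjoint , _ , covers) i =
    Q∈F i , F-resp (to , from) (F-⋃ m (Q ∘ punchIn i) (Q∈F ∘ punchIn i))
    where
    to : ⋃ (Fin m) (Q ∘ punchIn i) ⊆ ∁ (Q i)
    to (j , x∈Qj) x∈Qi = disjoint i (punchIn i j) (punchInᵢ≢i i j ∘ sym) (x∈Qi , x∈Qj)

    from : ∁ (Q i) ⊆ ⋃ (Fin m) (Q ∘ punchIn i)
    from {x} x∉Qi with j , x∈Qj ← covers {x} _ with i ≟ j
    ... | yes refl = contradiction x∈Qj x∉Qi
    ... | no i≢j   = punchOut i≢j , subst (λ l → Q l x) (sym (punchIn-punchOut i≢j)) x∈Qj

  -- Q is corrected to (Q ∖ (X ∩ Q)) ∪ (C ∖ Q), a finite modification.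
  almost-separated⇒class₂ : Infinite C → Infinite X → C ⊥ X → Complemented Q →
    Finite (C ∖ Q) → Finite (X ∩ Q) → (C ∷ X ∷ []) ∈ class 2 F
  almost-separated⇒class₂ {C} {X} {Q} C-inf X-inf C⊥X (Q∈F , ∁Q∈F) C∖Q-fin X∩Q-fin =
    (s≤s z≤n , (λ { zero → C-inf ; (suc zero) → X-inf }) , pairwise C⊥X) ,
    (R ∷ ∁ R ∷ []) ,
    ((λ { zero → R∈F ; (suc zero) → ∁R∈F }) , pairwise (λ (x∈R , x∉R) → x∉R x∈R) , _ , cover) ,
    s≤s z≤n , ≤-refl , id , id , λ { zero → C⊆R ; (suc zero) → X⊆∁R }
    where
    modify = proj₂ (proj₂ F-nontrivial)

    R : Subset S
    R = (Q ∖ (X ∩ Q)) ∪ (C ∖ Q)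

    pairwise : ∀ {V W : Subset S} → V ⊥ W → PairwiseDisjoint (V ∷ W ∷ [])
    pairwise V⊥W zero       zero       0≢0 = contradiction refl 0≢0
    pairwise V⊥W zero       (suc zero) _   = V⊥W
    pairwise V⊥W (suc zero) zero       _   = λ (x∈W , x∈V) → V⊥W (x∈V , x∈W)
    pairwise V⊥W (suc zero) (suc zero) 1≢1 = contradiction refl 1≢1

    R∈F : R ∈ F
    R∈F = proj₁ (modify _ (C ∖ Q) (proj₂ (modify Q (X ∩ Q) Q∈F X∩Q-fin)) C∖Q-fin)

    -- `∁ R` is likewise a finite modification of `∁ Q`, with adding and removing exchanged: `X ∩ Q`
    -- goes in, and the part of `C` outside `Q` comes out.
    to : ((∁ Q ∪ (X ∩ Q)) ∖ (C ∖ Q)) ⊆ ∁ R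
    to (_                , x∉C∖Q) (inj₂ x∈C∖Q)           = x∉C∖Q x∈C∖Q
    to (inj₁ x∉Q         , _    ) (inj₁ (x∈Q , _))       = x∉Q x∈Q
    to (inj₂ x∈X∩Q       , _    ) (inj₁ (_ , x∉X∩Q))     = x∉X∩Q x∈X∩Q

    from : ∁ R ⊆ ((∁ Q ∪ (X ∩ Q)) ∖ (C ∖ Q))
    from {x} x∉R with em₀ {(X ∩ Q) x}
    ... | yes x∈X∩Q = inj₂ x∈X∩Q , x∉R ∘ inj₂
    ... | no  x∉X∩Q = inj₁ (λ x∈Q → x∉R (inj₁ (x∈Q , x∉X∩Q))) , x∉R ∘ inj₂

    ∁R∈F : ∁ R ∈ F
    ∁R∈F = F-resp (to , from)
      (proj₂ (modify _ (C ∖ Q) (proj₁ (modify (∁ Q) (X ∩ Q) ∁Q∈F X∩Q-fin)) C∖Q-fin))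

    cover : U {ℓ = a} ⊆ ⋃ (Fin 2) (R ∷ ∁ R ∷ [])
    cover {x} _ with em₀ {R x}
    ... | yes x∈R = zero , x∈R
    ... | no  x∉R = suc zero , x∉R

    C⊆R : C ⊆ R
    C⊆R {x} x∈C with em₀ {Q x}
    ... | yes x∈Q = inj₁ (x∈Q , λ (x∈X , _) → C⊥X (x∈C , x∈X))
    ... | no  x∉Q = inj₂ (x∈C , x∉Q)

    X⊆∁R : X ⊆ ∁ R
    X⊆∁R x∈X (inj₁ (x∈Q , x∉X∩Q)) = x∉X∩Q (x∈X , x∈Q)
    X⊆∁R x∈X (inj₂ (x∈C , _))     = C⊥X (x∈C , x∈X)

  -- The ultrafilter of sets almost containing `C`.

  module AlmostContaining {C : Subset S} (C-cohesive : Cohesive F C) where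

    Large : Pred (Subset S) (a ⊔ b)
    Large Q = Complemented Q × Finite (C ∖ Q)

    U-large : Large U
    U-large = U-complemented , listed⇒finite List.[] (λ (_ , x∉U) → contradiction _ x∉U)

    ∩-large : Large P → Large Q → Large (P ∩ Q)
    ∩-large {P} {Q} (P-compl , xs , C∖P⊆xs , _) (Q-compl , ys , C∖Q⊆ys , _) =
      ∩-complemented P-compl Q-compl , listed⇒finite (xs ++ ys) listed
      where
      listed : ∀ {x} → (C ∖ (P ∩ Q)) x → x ∈ₗ xs ++ ys
      listed {x} (x∈C , x∉P∩Q) with em₀ {P x}
      ... | yes x∈P = ∈-++⁺ʳ xs (C∖Q⊆ys (x∈C , λ x∈Q → x∉P∩Q (x∈P , x∈Q)))
      ... | no  x∉P = ∈-++⁺ˡ (C∖P⊆xs (x∈C , x∉P))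

    -- This is where the dichotomy of cohesion enters: a finite `C ∩ Q` bounds what `C` has outside
    -- `∁ Q`.
    large-or-∁-large : Complemented Q → Large Q ⊎ Large (∁ Q)
    large-or-∁-large {Q} Q-compl with proj₂ C-cohesive Q (proj₁ Q-compl) (proj₂ Q-compl)
    ... | inj₂ C∖Q-fin = inj₁ (Q-compl , C∖Q-fin)
    ... | inj₁ C∩Q-fin = inj₂ (∁-complemented Q-compl ,
      finite-⊆ (λ (x∈C , x∉∁Q) → x∈C , decidable-stable em₀ x∉∁Q) C∩Q-fin)

    HasCode : ℕ → Pred (Subset S) (a ⊔ b)
    HasCode n Q = Σ (Q ∈ F) λ Q∈F → Large Q × Injection.to F-countable (Q , Q∈F) ≡ n

    -- Numbers that do not code a large set are sent to the whole of S.
    decode : ∀ n → Dec (Σ (Subset S) (HasCode n)) → Σ (Subset S) Large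
    decode n (yes (Q , _ , Q-large , _)) = Q , Q-large
    decode n (no _)                      = U , U-large

    enum : ℕ → Σ (Subset S) Large
    enum n = decode n em

    -- The set found at the code of `Q` may differ from `Q` as a predicate, but injectivity up to
    -- `≐` gives the two the same elements.
    enum-complete : Large Q → ∃[ n ] proj₁ (enum n) ⊆ Q
    enum-complete {Q} Q-large@((Q∈F , _) , _) = n , decode-⊆ em
      where
      n = Injection.to F-countable (Q , Q∈F)

      -- Stated for an arbitrary decision `d`, so that the `em` inside `enum` can be split by cases.
      decode-⊆ : ∀ d → proj₁ (decode n d) ⊆ Q
      decode-⊆ (yes (_ , _ , _ , code≡n)) = proj₁ (Injection.injective F-countable code≡n)
      decode-⊆ (no ∄Q)                      = contradiction (Q , Q∈F , Q-large , refl) ∄Q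

    -- Partial intersections turn the enumeration into the decreasing sequence that `Diagonal`
    -- requires.
    meet : ℕ → Subset S
    meet zero    = proj₁ (enum zero)
    meet (suc n) = meet n ∩ proj₁ (enum (suc n))

    meet-large : ∀ n → Large (meet n)
    meet-large zero    = proj₂ (enum zero)
    meet-large (suc n) = ∩-large (meet-large n) (proj₂ (enum (suc n)))

    meet⊆enum : ∀ n → meet n ⊆ proj₁ (enum n)
    meet⊆enum zero    = id
    meet⊆enum (suc n) = proj₂

    AlmostInLarge : Pred (Subset S) (lsuc a ⊔ b)
    AlmostInLarge Y = ∀ Q → Large Q → Finite (Y ∖ Q)

    -- A finite `X ∩ meet n` would let `meet n` separate `C` from `X` up to finite sets, against
    -- inseparability. So the sets `X ∩ meet n` can be diagonalised, and every large set contains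
    -- some `meet n`.
    thinning : Infinite X → C ⊥ X → (C ∷ X ∷ []) ∉ class 2 F →
               Σ (Subset S) λ Y → Y ⊆ X × Infinite Y × AlmostInLarge Y
    thinning {X} X-inf C⊥X inseparable = range , proj₁ ∘ range⊆X₀ , range-infinite , almost
      where
      X∩meet-infinite : ∀ n → Infinite (X ∩ meet n)
      X∩meet-infinite n X∩meet-fin with meet-compl , C∖meet-fin ← meet-large n =
        inseparable (almost-separated⇒class₂ (proj₁ C-cohesive) X-inf C⊥X meet-compl C∖meet-fin X∩meet-fin)

      open Diagonal (λ n → X ∩ meet n) X∩meet-infinite (λ _ (x∈X , x∈meet , _) → x∈X , x∈meet)

      almost : AlmostInLarge range
      almost Q Q-large with n , enum⊆Q ← enum-complete Q-large =
        finite-⊆ (λ (x∈range , x∉Q) → x∈range , λ (_ , x∈meet) → x∉Q (enum⊆Q (meet⊆enum n x∈meet)))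
                 (range∖X-finite n)

    -- Two components suffice for a contradiction: the part assigned to the first is large or has a
    -- large complement, so either every `B i` is almost inside it or every `B i` is almost outside.
    almostInLarge⇒core : ∀ {k} {B : Vector (Subset S) k} → 1 < k → IsClassificationProblem B →
                         (∀ i → AlmostInLarge (B i)) → B ∈ core k F
    almostInLarge⇒core {B = B} 1<k B-problem B-almost = 1<k , B-problem , unclassifiable
      where
      unclassifiable : ∀ m (A′ : Vector (Subset S) m) →
        IsClassificationProblem A′ → A′ ≼ B → 1 < m → A′ ∉ class m F
      unclassifiable (suc (suc _)) A′ (_ , A′-inf , _) (_ , _ , τ , _ , A′⊆B) (s≤s (s≤s _))
        (_ , Q , Q-partition@(_ , Q-disjoint , _) , _ , _ , σ , σ-inj , A′⊆Q)
        with large-or-∁-large (part-complemented Q-partition (σ zero))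
      -- The second component sits in a different part, hence outside this large one, and would be
      -- finite.
      ... | inj₁ large = A′-inf (suc zero)
        (finite-⊆ (λ x∈A′ → A′⊆B _ x∈A′ , λ x∈Q → Q-disjoint _ _ σ0≢σ1 (x∈Q , A′⊆Q _ x∈A′))
                  (B-almost (τ (suc zero)) _ large))
        where
        σ0≢σ1 : σ zero ≢ σ (suc zero)
        σ0≢σ1 σ0≡σ1 with () ← σ-inj σ0≡σ1
      -- The first component sits in the part itself, hence outside its large complement, and would
      -- be finite.
      ... | inj₂ ∁-large = A′-inf zero
        (finite-⊆ (λ x∈A′ → A′⊆B _ x∈A′ , λ x∉Q → x∉Q (A′⊆Q _ x∈A′))
                  (B-almost (τ zero) _ ∁-large))

theorem3p8 : {a b : Level} → ExcludedMiddle (lsuc a ⊔ b) →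
    (S : Set a) → Infinite {S = S} U →
    (F : Family S b) → F Respects _≐_ →
    Countable F → Nontrivial F →
    ClosedUnderFiniteUnions F → ClosedUnderFiniteIntersections F →
    (k : ℕ) → 2 ≤ k →
    (A : Vector (Subset S) k) → IsClassificationProblem A →
    (C : Subset S) → C ⊆ ∁ (⋃ (Fin k) A) → Cohesive F C →
    (∀ (i : Fin k) → (C ∷ A i ∷ []) ∉ class 2 F) →
    Σ (Vector (Subset S) k) λ B → B ≼ A × B ∈ core k F
theorem3p8 em S _ F F-resp F-countable F-nontrivial F-⋃ F-⋂ k 2≤k A (1≤k , A-inf , A-disjoint)
  C C⊆∁⋃A C-cohesive inseparable =
  -- Each component is thinned in place, so the identity serves as the index map and disjointness is
  -- inherited from `A`.
  B , (1≤k , ≤-refl , id , id , B⊆A) ,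
  almostInLarge⇒core 2≤k (1≤k , (λ i → proj₁ (proj₂ (proj₂ (thin i)))) , B-disjoint)
    (λ i → proj₂ (proj₂ (proj₂ (thin i))))
  where
  open Separation em F F-resp F-countable F-nontrivial F-⋃ F-⋂
  open AlmostContaining C-cohesive

  thin : ∀ i → Σ (Subset S) λ Y → Y ⊆ A i × Infinite Y × AlmostInLarge Y
  thin i = thinning (A-inf i) (λ (x∈C , x∈Ai) → C⊆∁⋃A x∈C (i , x∈Ai)) (inseparable i)

  B : Vector (Subset S) k
  B i = proj₁ (thin i)

  B⊆A : ∀ i → B i ⊆ A i
  B⊆A i = proj₁ (proj₂ (thin i))

  B-disjoint : PairwiseDisjoint B
  B-disjoint i j i≢j (x∈Bi , x∈Bj) = A-disjoint i j i≢j (B⊆A i x∈Bi , B⊆A j x∈Bj)
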